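{- For all $m\ge 3$, the Sperner systems $\mathcal{M}^m_1$ and $\mathcal{M}^m_2$ are strongly hypomorphic.
   Context: A set system over a finite set $A$ (the ground set) is a set of subsets of $A$, called blocks; it is a Sperner system if no block is included in another. Set systems $\mathcal A$ over $A$ and $\mathcal B$ over $B$ are isomorphic, $\mathcal A\equiv\mathcal B$, if there is a bijection $\sigma\colon A\to B$ with $\{\sigma(S):S\in\mathcal A\}=\mathcal B$. For a two-element subset $I$ of $A$, let $\theta_I$ be the equivalence relation on $A$ whose only nonsingleton class is $I$; for $S\subseteq A$ let $S_I=\{x/\theta_I:x\in S\}\subseteq A/\theta_I$; for a Sperner system $\mathcal A$ over $A$ let $\mathcal A_I=\{S_I:S\in\mathcal A\}$ and let $\mathcal A^*_I$ be the set of inclusion-minimal elements of $\mathcal A_I$, a Sperner system over $A/\theta_I$. Two Sperner systems $\mathcal A,\mathcal B$ over the same ground set $A$ are strongly hypomorphic if $\mathcal A^*_I\equiv\mathcal B^*_I$ for every two-element subset $I$ of $A$. Let $[m]=\{1,\dots,m\}$. For each $n\in[m]$ let $n'$ be a new element (a primed copy of $n$), and $S'=\{n':n\in S\}$ for $S\subseteq[m]$. Let $E_m=[m]\cup[m]'$, a set with $2m$ elements. Addition of elements of $[m]$ is modulo $m$ with result taken in $[m]$. For $J\subseteq[m]$ let $F^m_J=J\cup([m]\setminus J)'$. Put $\mathcal F^m_1=\{F^m_J: J\subseteq[m],\ |J|\text{ odd}\}$ and $\mathcal F^m_2=\{F^m_J: J\subseteq[m],\ |J|\text{ even}\}$. For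 $p\in[m]$ let $G^m_p=E_m\setminus\{p,p',(p+1)'\}$ and $\mathcal G^m=\{G^m_p:p\in[m]\}$. For $i\in\{1,2\}$, $\mathcal M^m_i=\mathcal F^m_i\cup\mathcal G^m$, a Sperner system over $E_m$. -}

module Defs where

open import Data.Empty using (⊥-elim)
open import Data.Fin using (Fin; zero; suc; toℕ)
open import Data.Fin.Properties using (_≟_)
open import Data.Fin.Subset using (Subset; ∣_∣) renaming (_∈_ to _∈ᶠ_; _∉_ to _∉ᶠ_)
open import Data.Fin.Subset.Properties using (_∈?_)
open import Data.Nat using (ℕ; zero; suc; _≤_; s≤s; parity)
open import Data.Nat.DivMod using (_mod_)
open import Data.Parity using (Parity; 0ℙ; 1ℙ)
open import Data.Product using (Σ-syntax; ∃; ∃-syntax; ∃₂; _×_; _,_; proj₁; proj₂)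
open import Data.Sum using (_⊎_; inj₁; inj₂)
open import Function.Base using (_∘_)
open import Function.Bundles using (Bijection; _⇔_)
open import Level using (Level; 0ℓ; _⊔_) renaming (suc to lsuc)
open import Relation.Binary using (Setoid; IsEquivalence)
open import Relation.Binary.Definitions using (_Respects_)
open import Relation.Binary.PropositionalEquality as ≡ using (_≡_; _≢_; refl; sym)
open import Relation.Nullary using (¬_; yes; no)
open import Relation.Unary using (Pred)
import Relation.Unary as U

private
  variable
    ℓ ℓ₁ ℓ₂ : Level

------------------------------------------------------------------------
-- Subsets of a ground set

-- Ground sets are setoids, so that the quotient A/θ_I is again a ground
-- set: same carrier, coarser equality.  A subset is a predicate that
-- does not distinguish equal elements.  The definitions do not use that
-- the ground set is finite; the ground sets E m below are.

GroundSet : Set₁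
GroundSet = Setoid 0ℓ 0ℓ

record SubsetOf (X : GroundSet) : Set₁ where
  open Setoid X
  field
    pred     : Pred Carrier 0ℓ
    respects : pred Respects _≈_

open SubsetOf public

infix 4 _∈_ _⊆_ _≐_

_∈_ : {X : GroundSet} → Setoid.Carrier X → SubsetOf X → Set
x ∈ S = pred S x

_⊆_ _≐_ : {X : GroundSet} → SubsetOf X → SubsetOf X → Set
S ⊆ T = pred S U.⊆ pred T
S ≐ T = pred S U.≐ pred T

≐-sym : {X : GroundSet} {S T : SubsetOf X} → S ≐ T → T ≐ S
≐-sym (S⊆T , T⊆S) = T⊆S , S⊆T

≐-trans : {X : GroundSet} {S T U : SubsetOf X} → S ≐ T → T ≐ U → S ≐ U
≐-trans (S⊆T , T⊆S) (T⊆U , U⊆T) = T⊆U ∘ S⊆T , T⊆S ∘ U⊆T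

------------------------------------------------------------------------
-- Set systems

-- A set of subsets, where subsets with the same elements are identified.

record SetSystem (X : GroundSet) (ℓ : Level) : Set (lsuc 0ℓ ⊔ lsuc ℓ) where
  field
    Block    : Pred (SubsetOf X) ℓ
    respects : Block Respects _≐_

open SetSystem public using (Block)

-- { f i : i ∈ ι }
familyOf : {X : GroundSet} {ι : Set ℓ} → (ι → SubsetOf X) → SetSystem X ℓ
familyOf f = record
  { Block    = λ S → ∃[ i ] S ≐ f i
  ; respects = λ {S} {T} S≐T (i , S≐fi) →
      i , ≐-trans {S = T} {S} {f i} (≐-sym {S = S} {T} S≐T) S≐fi
  }

infixr 6 _∪_

_∪_ : {X : GroundSet} → SetSystem X ℓ₁ → SetSystem X ℓ₂ → SetSystem X (ℓ₁ ⊔ ℓ₂)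
𝒜 ∪ ℬ = record
  { Block    = Block 𝒜 U.∪ Block ℬ
  ; respects = λ { S≐T (inj₁ S∈𝒜) → inj₁ (SetSystem.respects 𝒜 S≐T S∈𝒜)
                 ; S≐T (inj₂ S∈ℬ) → inj₂ (SetSystem.respects ℬ S≐T S∈ℬ) }
  }

-- "No block is included in another", with distinctness of blocks in
-- positive form; likewise for inclusion-minimality below.
IsSperner : {X : GroundSet} → SetSystem X ℓ → Set (lsuc 0ℓ ⊔ ℓ)
IsSperner 𝒜 = ∀ S T → Block 𝒜 S → Block 𝒜 T → S ⊆ T → S ≐ T

record SpernerSystem (X : GroundSet) (ℓ : Level) : Set (lsuc 0ℓ ⊔ lsuc ℓ) where
  field
    system    : SetSystem X ℓ
    isSperner : IsSperner system

open SpernerSystem public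

------------------------------------------------------------------------
-- Isomorphism

-- σ(S); closing under the equality of Y makes it a subset of Y.
image : {X Y : GroundSet} → Bijection X Y → SubsetOf X → SubsetOf Y
image {X} {Y} σ S = record
  { pred     = λ y → ∃[ x ] x ∈ S × Bijection.to σ x Y.≈ y
  ; respects = λ { y≈z (x , x∈S , σx≈y) → x , x∈S , Y.trans σx≈y y≈z }
  }
  where module Y = Setoid Y

-- { f S : S ∈ 𝒜 }
imageSystem : {X Y : GroundSet} → (SubsetOf X → SubsetOf Y) →
              SetSystem X ℓ → SetSystem Y (lsuc 0ℓ ⊔ ℓ)
imageSystem f 𝒜 = familyOf {ι = ∃ (Block 𝒜)} (f ∘ proj₁)

infix 4 _≅_

_≅_ : {X Y : GroundSet} → SetSystem X ℓ₁ → SetSystem Y ℓ₂ → Set (lsuc 0ℓ ⊔ ℓ₁ ⊔ ℓ₂)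
_≅_ {X = X} {Y} 𝒜 ℬ =
  Σ[ σ ∈ Bijection X Y ] (∀ T → Block (imageSystem (image σ) 𝒜) T ⇔ Block ℬ T)

------------------------------------------------------------------------
-- Identification of the elements of I

IsTwoElement : {X : GroundSet} → SubsetOf X → Set
IsTwoElement {X} I =
  ∃₂ λ a b → ¬ (a ≈ b) × (∀ x → x ∈ I ⇔ (x ≈ a ⊎ x ≈ b))
  where open Setoid X

θ : {X : GroundSet} → SubsetOf X → Setoid.Carrier X → Setoid.Carrier X → Set
θ {X} I x y = x ≈ y ⊎ (x ∈ I × y ∈ I)
  where open Setoid X

θ-isEquivalence : {X : GroundSet} (I : SubsetOf X) → IsEquivalence (θ I)
θ-isEquivalence {X} I = record
  { refl  = inj₁ X.refl
  ; sym   = λ { (inj₁ x≈y) → inj₁ (X.sym x≈y)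
              ; (inj₂ (x∈I , y∈I)) → inj₂ (y∈I , x∈I) }
  ; trans = λ { (inj₁ x≈y) (inj₁ y≈z) → inj₁ (X.trans x≈y y≈z)
              ; (inj₁ x≈y) (inj₂ (y∈I , z∈I)) →
                  inj₂ (SubsetOf.respects I (X.sym x≈y) y∈I , z∈I)
              ; (inj₂ (x∈I , y∈I)) (inj₁ y≈z) →
                  inj₂ (x∈I , SubsetOf.respects I y≈z y∈I)
              ; (inj₂ (x∈I , _)) (inj₂ (_ , z∈I)) → inj₂ (x∈I , z∈I) }
  }
  where module X = Setoid X

infix 8 _/_

_/_ : (X : GroundSet) → SubsetOf X → GroundSet
X / I = record { isEquivalence = θ-isEquivalence I }

-- S_I: the class of y belongs to it iff y is θ_I-related to a member of S.
collapse : {X : GroundSet} (I : SubsetOf X) → SubsetOf X → SubsetOf (X / I)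
collapse {X} I S = record
  { pred     = λ y → ∃[ x ] x ∈ S × θ I x y
  ; respects = λ { yθz (x , x∈S , xθy) →
                   x , x∈S , IsEquivalence.trans (θ-isEquivalence I) xθy yθz }
  }

collapseSystem : {X : GroundSet} (I : SubsetOf X) →
                 SetSystem X ℓ → SetSystem (X / I) (lsuc 0ℓ ⊔ ℓ)
collapseSystem I = imageSystem (collapse I)

minimal : {X : GroundSet} → SetSystem X ℓ → SpernerSystem X (lsuc 0ℓ ⊔ ℓ)
minimal 𝒜 = record
  { system = record
    { Block    = λ S → Block 𝒜 S × (∀ T → Block 𝒜 T → T ⊆ S → S ⊆ T)
    ; respects = λ { S≐T@(S⊆T , T⊆S) (S∈𝒜 , S-min) →
          SetSystem.respects 𝒜 S≐T S∈𝒜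
        , λ U U∈𝒜 U⊆T → S-min U U∈𝒜 (T⊆S ∘ U⊆T) ∘ T⊆S }
    }
  ; isSperner = λ { S T (S∈𝒜 , _) (_ , T-min) S⊆T → S⊆T , T-min S S∈𝒜 S⊆T }
  }

_*[_] : {X : GroundSet} → SpernerSystem X ℓ → (I : SubsetOf X) →
        SpernerSystem (X / I) (lsuc 0ℓ ⊔ ℓ)
𝒜 *[ I ] = minimal (collapseSystem I (system 𝒜))

StronglyHypomorphic : {X : GroundSet} →
  SpernerSystem X ℓ₁ → SpernerSystem X ℓ₂ → Set (lsuc 0ℓ ⊔ ℓ₁ ⊔ ℓ₂)
StronglyHypomorphic {X = X} 𝒜 ℬ =
  ∀ (I : SubsetOf X) → IsTwoElement I → system (𝒜 *[ I ]) ≅ system (ℬ *[ I ])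

------------------------------------------------------------------------
-- The systems ℳ₁ and ℳ₂

-- Fin m stands for [m], the number n ∈ [m] being the element n - 1 of
-- Fin m; adding 1 modulo m is compatible with this shift.
-- In E m, inj₁ n is n and inj₂ n is n′.

E : ℕ → GroundSet
E m = ≡.setoid (Fin m ⊎ Fin m)

next : ∀ {m} → Fin m → Fin m
next {suc k} p = suc (toℕ p) mod suc k

F : ∀ {m} → Subset m → SubsetOf (E m)
F J = record
  { pred     = λ { (inj₁ n) → n ∈ᶠ J ; (inj₂ n) → n ∉ᶠ J }
  ; respects = λ { refl x∈F → x∈F }
  }

G : ∀ {m} → Fin m → SubsetOf (E m)
G p = record
  { pred     = λ x → x ≢ inj₁ p × x ≢ inj₂ p × x ≢ inj₂ (next p)
  ; respects = λ { refl x∈G → x∈G }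
  }

-- { F J : |J| has parity π }
ℱ : ∀ m → Parity → SetSystem (E m) 0ℓ
ℱ m π = familyOf {ι = Σ[ J ∈ Subset m ] parity ∣ J ∣ ≡ π} (F ∘ proj₁)

𝒢 : ∀ m → SetSystem (E m) 0ℓ
𝒢 m = familyOf {ι = Fin m} G

private
  third : ∀ {m} → 3 ≤ m → (p q : Fin m) → ∃[ r ] r ≢ p × r ≢ q
  third (s≤s (s≤s (s≤s _))) zero zero = suc zero , (λ ()) , (λ ())
  third (s≤s (s≤s (s≤s _))) zero (suc zero) = suc (suc zero) , (λ ()) , (λ ())
  third (s≤s (s≤s (s≤s _))) zero (suc (suc _)) = suc zero , (λ ()) , (λ ())
  third (s≤s (s≤s (s≤s _))) (suc zero) zero = suc (suc zero) , (λ ()) , (λ ())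
  third (s≤s (s≤s (s≤s _))) (suc (suc _)) zero = suc zero , (λ ()) , (λ ())
  third (s≤s (s≤s (s≤s _))) (suc _) (suc _) = zero , (λ ()) , (λ ())

  F⊆F⇒≐ : ∀ {m} (J K : Subset m) → F J ⊆ F K → F J ≐ F K
  F⊆F⇒≐ J K J⊆K = J⊆K , λ {x} → K⊆J x
    where
    K⊆J : ∀ x → x ∈ F K → x ∈ F J
    K⊆J (inj₁ n) n∈K with n ∈? J
    ... | yes n∈J = n∈J
    ... | no  n∉J = ⊥-elim (J⊆K {inj₂ n} n∉J n∈K)
    K⊆J (inj₂ n) n∉K n∈J = n∉K (J⊆K {inj₁ n} n∈J)

  F⊈G : ∀ {m} (J : Subset m) p → ¬ (F J ⊆ G p)
  F⊈G J p J⊆G with p ∈? J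
  ... | yes p∈J = proj₁ (J⊆G {inj₁ p} p∈J) refl
  ... | no  p∉J = proj₁ (proj₂ (J⊆G {inj₂ p} p∉J)) refl

  G⊈F : ∀ {m} → 3 ≤ m → (J : Subset m) → ∀ p → ¬ (G p ⊆ F J)
  G⊈F m≥3 J p G⊆J with third m≥3 p (next p)
  ... | r , r≢p , r≢p+1 =
    G⊆J {inj₂ r} ((λ ()) , (λ { refl → r≢p refl }) , (λ { refl → r≢p+1 refl }))
        (G⊆J {inj₁ r} ((λ { refl → r≢p refl }) , (λ ()) , (λ ())))

  G⊆G⇒≡ : ∀ {m} (p q : Fin m) → G p ⊆ G q → p ≡ q
  G⊆G⇒≡ p q p⊆q with q ≟ p
  ... | yes q≡p = sym q≡p
  ... | no  q≢p =
    ⊥-elim (proj₁ (p⊆q {inj₁ q} ((λ { refl → q≢p refl }) , (λ ()) , (λ ()))) refl)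

ℱ∪𝒢-isSperner : ∀ {m} → 3 ≤ m → ∀ π → IsSperner (ℱ m π ∪ 𝒢 m)
ℱ∪𝒢-isSperner m≥3 π S T (inj₁ ((J , _) , S⊆J , J⊆S)) (inj₁ ((K , _) , T⊆K , K⊆T)) S⊆T =
  S⊆T , J⊆S ∘ proj₂ (F⊆F⇒≐ J K (T⊆K ∘ S⊆T ∘ J⊆S)) ∘ T⊆K
ℱ∪𝒢-isSperner m≥3 π S T (inj₁ ((J , _) , _ , J⊆S)) (inj₂ (p , T⊆p , _)) S⊆T =
  ⊥-elim (F⊈G J p (T⊆p ∘ S⊆T ∘ J⊆S))
ℱ∪𝒢-isSperner m≥3 π S T (inj₂ (p , _ , p⊆S)) (inj₁ ((K , _) , T⊆K , _)) S⊆T =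
  ⊥-elim (G⊈F m≥3 K p (λ {x} → T⊆K {x} ∘ S⊆T ∘ p⊆S))
ℱ∪𝒢-isSperner m≥3 π S T (inj₂ (p , _ , p⊆S)) (inj₂ (q , T⊆q , _)) S⊆T
  with G⊆G⇒≡ p q (T⊆q ∘ S⊆T ∘ p⊆S)
... | refl = S⊆T , p⊆S ∘ T⊆q

ℳ₁ ℳ₂ : ∀ m → 3 ≤ m → SpernerSystem (E m) 0ℓ
ℳ₁ m m≥3 = record { system = ℱ m 1ℙ ∪ 𝒢 m ; isSperner = ℱ∪𝒢-isSperner m≥3 1ℙ }
ℳ₂ m m≥3 = record { system = ℱ m 0ℙ ∪ 𝒢 m ; isSperner = ℱ∪𝒢-isSperner m≥3 0ℙ }

{-# OPTIONS --safe #-}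

-- Let I = {a, b}, where a and b are p or p′ and q or q′ respectively.
--
-- If p = q, toggling p in J changes the parity of |J| but not the collapse
-- of F J, so the two collapsed systems coincide.
--
-- If p ≠ q, then p + 1 ≠ q or q + 1 ≠ p because m ≥ 3; say p + 1 ≠ q, and let
-- σ exchange s = p + 1 and s′.  It fixes I pointwise, toggles s in every F J
-- and fixes every G r with r ≠ p.  The remaining block G p is irrelevant: its
-- collapse contains the collapse of any F K with s ∈ K and a ∈ F K, and the
-- parity of |K| is still free since K may be toggled at q.  So σ induces an
-- isomorphism of the systems of minimal blocks.
module Submission where

open import Defs
open import Data.Bool using (not)
open import Data.Bool.Properties using (not-involutive)
open import Data.Empty using (⊥-elim)
open import Data.Fin using (Fin; zero; suc; toℕ)
open import Data.Fin.Properties using (_≟_; toℕ-injective; toℕ<n; toℕ-fromℕ<)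
open import Data.Fin.Subset using (Subset; ∣_∣; inside; outside; ⊤)
  renaming (_∈_ to _∈ᶠ_)
open import Data.Fin.Subset.Properties using (∈⊤)
open import Data.Nat using (ℕ; zero; suc; _≤_; _<_; s≤s; _%_; parity)
open import Data.Nat.DivMod using (m%n<n; m<n⇒m%n≡m; n%n≡0)
open import Data.Nat.Properties using (m≤n⇒m<n∨m≡n; 1+n≢n; m+1+n≢n; suc-injective)
open import Data.Parity using (Parity; 0ℙ; 1ℙ; _⁻¹)
open import Data.Parity.Properties using (⁻¹-selfInverse; suc-homo-⁻¹)
  renaming (_≟_ to _≟ℙ_)
open import Data.Product using (∃-syntax; _×_; _,_)
open import Data.Sum using (_⊎_; inj₁; inj₂; reduce)
import Data.Sum as Sum
open import Data.Sum.Properties using (swap-involutive)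
open import Data.Vec using (_∷_; here; there; updateAt)
open import Data.Vec.Properties
  using (updateAt-minimal; updateAt-updateAt; updateAt-id-local)
open import Function.Base using (id; _∘_)
open import Function.Bundles using (Bijection; Equivalence; mk⇔)
open import Level using (Level)
open import Relation.Binary using (Setoid)
open import Relation.Binary.PropositionalEquality
  using (_≡_; _≢_; refl; sym; trans; cong; subst; module ≡-Reasoning)
open import Relation.Nullary using (¬_; yes; no)

private
  variable
    ℓ₁ ℓ₂ : Level
    m : ℕ

-- Involutions and minimal blocks

record Involution (X : GroundSet) : Set where
  open Setoid X
  field
    map        : Carrier → Carrier
    map-cong   : ∀ {x y} → x ≈ y → map x ≈ map y
    involutive : ∀ x → map (map x) ≈ x

module _ {X : GroundSet} (σ : Involution X) where
  open Setoid X using (_≈_) renaming (sym to ≈-sym; trans to ≈-trans)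
  open Involution σ

  -- This stands in for the image: the map is its own inverse, and membership needs no existential.
  preimage : SubsetOf X → SubsetOf X
  preimage S = record
    { pred     = λ x → map x ∈ S
    ; respects = λ x≈y → respects S (map-cong x≈y)
    }

  bijection : Bijection X X
  bijection = record
    { to        = map
    ; cong      = map-cong
    ; bijective =
        (λ {x} {y} fx≈fy →
          ≈-trans (≈-sym (involutive x)) (≈-trans (map-cong fx≈fy) (involutive y)))
      , λ y → map y , λ z≈fy → ≈-trans (map-cong z≈fy) (involutive y)
    }

  image≐preimage : ∀ S → image bijection S ≐ preimage S
  image≐preimage S =
      (λ { {y} (x , x∈S , fx≈y) →
        respects S (≈-trans (≈-sym (involutive x)) (map-cong fx≈y)) x∈S })
    , λ {y} fy∈S → map y , fy∈S , involutive y

  preimage-involutive : ∀ S → preimage (preimage S) ≐ S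
  preimage-involutive S =
      (λ {x} → respects S (involutive x))
    , λ {x} → respects S (≈-sym (involutive x))

  -- Only some block below `S` has to be carried into `ℬ`, so a non-minimal block without a
  -- counterpart does no harm.
  Transfers : SetSystem X ℓ₁ → SetSystem X ℓ₂ → Set _
  Transfers 𝒜 ℬ = ∀ S → Block 𝒜 S → ∃[ T ] Block 𝒜 T × T ⊆ S × Block ℬ (preimage T)

  -- The transferred `T` below a minimal `S` equals `S`. If a block `U` of `ℬ` lies in `preimage S`,
  -- transferring back gives `V ⊆ U` with `preimage V` a block inside `S`. Minimality gives
  -- `S ⊆ preimage V`, hence `preimage S ⊆ V ⊆ U`.
  minimal-preimage : (𝒜 : SetSystem X ℓ₁) (ℬ : SetSystem X ℓ₂) →
    Transfers 𝒜 ℬ → Transfers ℬ 𝒜 →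
    ∀ S → Block (system (minimal 𝒜)) S → Block (system (minimal ℬ)) (preimage S)
  minimal-preimage 𝒜 ℬ 𝒜→ℬ ℬ→𝒜 S (S∈𝒜 , S-min)
    with T , T∈𝒜 , T⊆S , T′∈ℬ ← 𝒜→ℬ S S∈𝒜
    =   SetSystem.respects ℬ {preimage T} {preimage S}
          ((λ {x} → T⊆S {map x}) , λ {x} → S-min T T∈𝒜 T⊆S {map x}) T′∈ℬ
      , λ U U∈ℬ U⊆S′ → minimality U (ℬ→𝒜 U U∈ℬ) U⊆S′
    where
    minimality : ∀ U → ∃[ V ] Block ℬ V × V ⊆ U × Block 𝒜 (preimage V) →
                 U ⊆ preimage S → preimage S ⊆ U
    minimality U (V , _ , V⊆U , V′∈𝒜) U⊆S′ {x} fx∈S =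
      V⊆U (respects V (involutive x)
        (S-min (preimage V) V′∈𝒜
          (λ {y} fy∈V → respects S (involutive y) (U⊆S′ (V⊆U fy∈V))) fx∈S))

  minimal-≅ : (𝒜 : SetSystem X ℓ₁) (ℬ : SetSystem X ℓ₂) →
    Transfers 𝒜 ℬ → Transfers ℬ 𝒜 → system (minimal 𝒜) ≅ system (minimal ℬ)
  minimal-≅ 𝒜 ℬ 𝒜→ℬ ℬ→𝒜 = bijection , λ T → mk⇔ (to T) (from T)
    where
    module ℬ* = SetSystem (system (minimal ℬ))

    to : ∀ T → Block (imageSystem (image bijection) (system (minimal 𝒜))) T → ℬ*.Block T
    to T ((S , S∈) , T≐σS) =
      ℬ*.respects {preimage S} {T}
        (≐-sym {S = T} {preimage S}
          (≐-trans {S = T} {image bijection S} {preimage S} T≐σS (image≐preimage S)))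
        (minimal-preimage 𝒜 ℬ 𝒜→ℬ ℬ→𝒜 S S∈)

    from : ∀ T → ℬ*.Block T → Block (imageSystem (image bijection) (system (minimal 𝒜))) T
    from T T∈ =
        (preimage T , minimal-preimage ℬ 𝒜 ℬ→𝒜 𝒜→ℬ T T∈)
      , ≐-sym {S = image bijection (preimage T)} {T}
          (≐-trans {S = image bijection (preimage T)} {preimage (preimage T)} {T}
            (image≐preimage (preimage T)) (preimage-involutive T))

-- Collapsing along `I`

module _ {X : GroundSet} (I : SubsetOf X) where
  open Setoid X using () renaming (refl to ≈-refl)

  ∈-collapse : ∀ S {x} → x ∈ S → x ∈ collapse I S
  ∈-collapse S {x} x∈S = x , x∈S , inj₁ ≈-refl

  collapse-⊆ : ∀ S T → (∀ x → x ∈ S → x ∈ collapse I T) → collapse I S ⊆ collapse I T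
  collapse-⊆ S T S⊆T (x , x∈S , xθy) = respects (collapse I T) xθy (S⊆T x x∈S)

  collapse-mono : ∀ S T → S ⊆ T → collapse I S ⊆ collapse I T
  collapse-mono S T S⊆T = collapse-⊆ S T (λ x → ∈-collapse T ∘ S⊆T)

  -- `Transfers` in terms of blocks before collapsing. `T` may differ from `S`, which later lets
  -- some `F K` replace `G p`.
  Dominates : Involution (X / I) → SetSystem X ℓ₁ → SetSystem X ℓ₂ → SubsetOf X → Set _
  Dominates σ 𝒜 ℬ S = ∃[ T ] ∃[ U ] Block 𝒜 T × Block ℬ U ×
    collapse I T ⊆ collapse I S × preimage σ (collapse I T) ≐ collapse I U

  collapse-transfers : (σ : Involution (X / I)) (𝒜 : SetSystem X ℓ₁) (ℬ : SetSystem X ℓ₂) →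
    (∀ S → Block 𝒜 S → Dominates σ 𝒜 ℬ S) →
    Transfers σ (collapseSystem I 𝒜) (collapseSystem I ℬ)
  collapse-transfers σ 𝒜 ℬ dom S ((S₀ , S₀∈𝒜) , _ , S₀⊆S)
    with T , U , T∈𝒜 , U∈ℬ , T⊆S₀ , T≐U ← dom S₀ S₀∈𝒜
    = collapse I T , ((T , T∈𝒜) , id , id) , S₀⊆S ∘ T⊆S₀ , ((U , U∈ℬ) , T≐U)

-- The cyclic successor

toℕ-next : (p : Fin m) →
  (suc (toℕ p) < m × toℕ (next p) ≡ suc (toℕ p)) ⊎ (suc (toℕ p) ≡ m × toℕ (next p) ≡ 0)
toℕ-next {suc k} p with m≤n⇒m<n∨m≡n (toℕ<n p)
... | inj₁ p+1<m =
  inj₁ (p+1<m , trans (toℕ-fromℕ< (m%n<n (suc (toℕ p)) (suc k))) (m<n⇒m%n≡m p+1<m))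
... | inj₂ p+1≡m = inj₂ (p+1≡m , (begin
  toℕ (next p)           ≡⟨ toℕ-fromℕ< (m%n<n (suc (toℕ p)) (suc k)) ⟩
  suc (toℕ p) % suc k    ≡⟨ cong (_% suc k) p+1≡m ⟩
  suc k % suc k          ≡⟨ n%n≡0 (suc k) ⟩
  0                      ∎))
  where open ≡-Reasoning

next-injective : (p q : Fin m) → next p ≡ next q → p ≡ q
next-injective p q eq with toℕ-next p | toℕ-next q
... | inj₁ (_ , p′) | inj₁ (_ , q′) =
  toℕ-injective (suc-injective (trans (sym p′) (trans (cong toℕ eq) q′)))
... | inj₂ (p+1≡m , _) | inj₂ (q+1≡m , _) =
  toℕ-injective (suc-injective (trans p+1≡m (sym q+1≡m)))
... | inj₁ (_ , p′) | inj₂ (_ , q′) with () ← trans (sym p′) (trans (cong toℕ eq) q′)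
... | inj₂ (_ , p′) | inj₁ (_ , q′) with () ← trans (sym q′) (trans (cong toℕ (sym eq)) p′)

next≢ : 3 ≤ m → (p : Fin m) → next p ≢ p
next≢ m≥3 p eq with toℕ-next p
... | inj₁ (_ , p′) = 1+n≢n (trans (sym p′) (cong toℕ eq))
-- Wrapping around to `p` itself would mean p = 0 and m = 1.
next≢ (s≤s (s≤s _)) p eq | inj₂ (p+1≡m , p′)
  with () ← trans (sym (cong suc (trans (cong toℕ (sym eq)) p′))) p+1≡m

-- Without wrap-around p + 2 = p; one wrap forces m = 2, two force m = 1.
next-next≢ : 3 ≤ m → (p : Fin m) → next (next p) ≢ p
next-next≢ m≥3 p eq with toℕ-next p | toℕ-next (next p) | cong toℕ eq
... | inj₁ (_ , p′) | inj₁ (_ , p″) | e =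
  m+1+n≢n 1 (trans (cong suc (sym p′)) (trans (sym p″) e))
next-next≢ (s≤s (s≤s (s≤s _))) p eq | inj₁ (_ , p′) | inj₂ (p+2≡m , p″) | e
  with () ← trans (sym (cong suc (trans p′ (cong suc (trans (sym e) p″))))) p+2≡m
next-next≢ (s≤s (s≤s (s≤s _))) p eq | inj₂ (p+1≡m , p′) | inj₁ (_ , p″) | e
  with () ← trans (sym (cong suc (trans (sym e) (trans p″ (cong suc p′))))) p+1≡m
next-next≢ (s≤s (s≤s (s≤s _))) p eq | inj₂ (_ , p′) | inj₂ (p+2≡m , _) | e
  with () ← trans (sym (cong suc p′)) p+2≡m

-- Exchanging s and s′

swapAt : Fin m → Fin m ⊎ Fin m → Fin m ⊎ Fin m
swapAt s x with reduce x ≟ s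
... | yes _ = Sum.swap x
... | no  _ = x

reduce-swap : (x : Fin m ⊎ Fin m) → reduce (Sum.swap x) ≡ reduce x
reduce-swap (inj₁ _) = refl
reduce-swap (inj₂ _) = refl

swapAt-≡ : ∀ (s : Fin m) x → reduce x ≡ s → swapAt s x ≡ Sum.swap x
swapAt-≡ s x x≡s with reduce x ≟ s
... | yes _   = refl
... | no  x≢s = ⊥-elim (x≢s x≡s)

swapAt-≢ : ∀ (s : Fin m) x → reduce x ≢ s → swapAt s x ≡ x
swapAt-≢ s x x≢s with reduce x ≟ s
... | yes x≡s = ⊥-elim (x≢s x≡s)
... | no  _   = refl

reduce-swapAt : ∀ (s : Fin m) x → reduce (swapAt s x) ≡ reduce x
reduce-swapAt s x with reduce x ≟ s
... | yes _ = reduce-swap x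
... | no  _ = refl

swapAt-involutive : ∀ (s : Fin m) x → swapAt s (swapAt s x) ≡ x
swapAt-involutive s x with reduce x ≟ s
... | yes x≡s = trans (swapAt-≡ s (Sum.swap x) (trans (reduce-swap x) x≡s)) (swap-involutive x)
... | no  x≢s = swapAt-≢ s x x≢s

-- `reduce` forgets the prime and `Sum.swap` toggles it, so the fibre over n is {n, n′}.
≡-or-swap : (x y : Fin m ⊎ Fin m) → reduce x ≡ reduce y → x ≡ y ⊎ x ≡ Sum.swap y
≡-or-swap (inj₁ _) (inj₁ _) refl = inj₁ refl
≡-or-swap (inj₁ _) (inj₂ _) refl = inj₂ refl
≡-or-swap (inj₂ _) (inj₁ _) refl = inj₂ refl
≡-or-swap (inj₂ _) (inj₂ _) refl = inj₁ refl

-- The blocks F J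

toggle : Fin m → Subset m → Subset m
toggle s J = updateAt J s not

toggle-involutive : ∀ (s : Fin m) J → toggle s (toggle s J) ≡ J
toggle-involutive s J =
  trans (updateAt-updateAt s J) (updateAt-id-local s J (not-involutive _))

parity-suc : ∀ n → parity (suc n) ≡ parity n ⁻¹
parity-suc n = sym (⁻¹-selfInverse (suc-homo-⁻¹ n))

parity-toggle : ∀ (s : Fin m) J → parity ∣ toggle s J ∣ ≡ parity ∣ J ∣ ⁻¹
parity-toggle zero    (inside  ∷ J) = sym (suc-homo-⁻¹ ∣ J ∣)
parity-toggle zero    (outside ∷ J) = parity-suc ∣ J ∣
parity-toggle (suc s) (outside ∷ J) = parity-toggle s J
parity-toggle (suc s) (inside  ∷ J) = begin
  parity (suc ∣ toggle s J ∣)  ≡⟨ parity-suc ∣ toggle s J ∣ ⟩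
  parity ∣ toggle s J ∣ ⁻¹     ≡⟨ cong _⁻¹ (parity-toggle s J) ⟩
  parity ∣ J ∣ ⁻¹ ⁻¹           ≡⟨ cong _⁻¹ (parity-suc ∣ J ∣) ⟨
  parity (suc ∣ J ∣) ⁻¹        ∎
  where open ≡-Reasoning

∈⇒∉toggle : ∀ (s : Fin m) J → s ∈ᶠ J → ¬ s ∈ᶠ toggle s J
∈⇒∉toggle zero    (inside ∷ J) here       ()
∈⇒∉toggle (suc s) (_ ∷ J)      (there s∈) (there s∈′) = ∈⇒∉toggle s J s∈ s∈′

∉⇒∈toggle : ∀ (s : Fin m) J → ¬ s ∈ᶠ J → s ∈ᶠ toggle s J
∉⇒∈toggle zero    (inside  ∷ J) s∉J = ⊥-elim (s∉J here)
∉⇒∈toggle zero    (outside ∷ J) s∉J = here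
∉⇒∈toggle (suc s) (_ ∷ J)       s∉J = there (∉⇒∈toggle s J (s∉J ∘ there))

-- `F J` contains exactly one of s and s′, and toggling s in `J` changes which one.
F-toggle : ∀ (s : Fin m) J x → x ∈ F J → swapAt s x ∈ F (toggle s J)
F-toggle s J x x∈F with reduce x ≟ s
F-toggle s J (inj₁ .s) s∈J | yes refl = ∈⇒∉toggle s J s∈J
F-toggle s J (inj₂ .s) s∉J | yes refl = ∉⇒∈toggle s J s∉J
F-toggle s J (inj₁ n) n∈J | no n≢s = updateAt-minimal n s J n≢s n∈J
-- Were n in `toggle s J`, it would survive a second toggle at s, which restores `J`.
F-toggle s J (inj₂ n) n∉J | no n≢s = λ n∈ →
  n∉J (subst (n ∈ᶠ_) (toggle-involutive s J) (updateAt-minimal n s (toggle s J) n≢s n∈))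

F-toggle⁻ : ∀ (s : Fin m) J x → x ∈ F (toggle s J) → swapAt s x ∈ F J
F-toggle⁻ s J x x∈F =
  subst (λ K → swapAt s x ∈ F K) (toggle-involutive s J) (F-toggle s (toggle s J) x x∈F)

F-toggle-≢ : ∀ (s : Fin m) J x → reduce x ≢ s → x ∈ F J → x ∈ F (toggle s J)
F-toggle-≢ s J x x≢s x∈F = subst (_∈ F (toggle s J)) (swapAt-≢ s x x≢s) (F-toggle s J x x∈F)

swap∉F : ∀ (J : Subset m) x → x ∈ F J → ¬ (Sum.swap x ∈ F J)
swap∉F J (inj₁ _) x∈J x∉J = x∉J x∈J
swap∉F J (inj₂ _) x∉J x∈J = x∉J x∈J

-- The full set serves for unprimed `a`; for a = t′, remove t from it, which leaves s in place.
∃F-through : ∀ a (s : Fin m) → reduce a ≢ s → ∃[ J ] a ∈ F J × s ∈ᶠ J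
∃F-through (inj₁ t) s t≢s = ⊤ , ∈⊤ , ∈⊤
∃F-through (inj₂ t) s t≢s =
    toggle t ⊤
  , subst (_∈ F (toggle t ⊤)) (swapAt-≡ t (inj₁ t) refl) (F-toggle t ⊤ (inj₁ t) ∈⊤)
  , F-toggle-≢ t ⊤ (inj₁ s) (t≢s ∘ sym) ∈⊤

≢⇒⁻¹≡ : ∀ {p q} → p ≢ q → p ⁻¹ ≡ q
≢⇒⁻¹≡ {0ℙ} {0ℙ} p≢q = ⊥-elim (p≢q refl)
≢⇒⁻¹≡ {0ℙ} {1ℙ} p≢q = refl
≢⇒⁻¹≡ {1ℙ} {0ℙ} p≢q = refl
≢⇒⁻¹≡ {1ℙ} {1ℙ} p≢q = ⊥-elim (p≢q refl)

-- The index `o` is spare: toggling there corrects the parity and disturbs neither `a` nor `s`.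
∃F-through-parity : ∀ π (o : Fin m) a s → reduce a ≢ o → s ≢ o → reduce a ≢ s →
  ∃[ K ] parity ∣ K ∣ ≡ π × a ∈ F K × s ∈ᶠ K
∃F-through-parity π o a s a≢o s≢o a≢s with ∃F-through a s a≢s
... | J , a∈J , s∈J with parity ∣ J ∣ ≟ℙ π
...   | yes J≡π = J , J≡π , a∈J , s∈J
...   | no  J≢π =
    toggle o J , trans (parity-toggle o J) (≢⇒⁻¹≡ J≢π)
  , F-toggle-≢ o J a a≢o a∈J , F-toggle-≢ o J (inj₁ s) s≢o s∈J

-- The blocks G r

∈G⇒reduce≢ : ∀ (r : Fin m) x → x ∈ G r → reduce x ≢ r
∈G⇒reduce≢ r (inj₁ _) (x≢r , _ , _) refl = x≢r refl
∈G⇒reduce≢ r (inj₂ _) (_ , x≢r′ , _) refl = x≢r′ refl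

reduce≢⇒∈G : ∀ (r : Fin m) x → reduce x ≢ r → x ≢ inj₂ (next r) → x ∈ G r
reduce≢⇒∈G r x x≢r x≢r+1 = (λ { refl → x≢r refl }) , (λ { refl → x≢r refl }) , x≢r+1

-- `G r` omits both r and r′; it tells n from n′ only at n = r + 1, which the exchange does not
-- touch.
G-swapAt : ∀ (s r : Fin m) x → next r ≢ s → x ∈ G r → swapAt s x ∈ G r
G-swapAt s r x r+1≢s x∈G@(_ , _ , x≢r+1) =
  reduce≢⇒∈G r (swapAt s x) (λ eq → ∈G⇒reduce≢ r x x∈G (trans (sym (reduce-swapAt s x)) eq))
    λ eq → x≢r+1 (trans
      (sym (swapAt-≢ s x λ x≡s → r+1≢s
        (trans (cong reduce (sym eq)) (trans (reduce-swapAt s x) x≡s)))) eq)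

-- Transfers between the two parities

ℳ : ∀ m → Parity → SetSystem (E m) _
ℳ m π = ℱ m π ∪ 𝒢 m

F∈ℳ : ∀ {π} (J : Subset m) → parity ∣ J ∣ ≡ π → Block (ℳ m π) (F J)
F∈ℳ J J≡π = inj₁ ((J , J≡π) , id , id)

G∈ℳ : ∀ {π} (r : Fin m) → Block (ℳ m π) (G r)
G∈ℳ r = inj₂ (r , id , id)

toggle∈ℳ : ∀ {π} (s : Fin m) J → parity ∣ J ∣ ≡ π → Block (ℳ m (π ⁻¹)) (F (toggle s J))
toggle∈ℳ s J J≡π = F∈ℳ (toggle s J) (trans (parity-toggle s J) (cong _⁻¹ J≡π))

module _ (I : SubsetOf (E m)) where

  identity : Involution (E m / I)
  identity = record { map = id ; map-cong = id ; involutive = λ _ → inj₁ refl }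

  -- Both p and p′ lie in `I`, so exchanging them does not change any class.
  collapse-toggle : (p : Fin m) → (∀ x → reduce x ≡ p → x ∈ I) →
    ∀ J x → x ∈ F J → x ∈ collapse I (F (toggle p J))
  collapse-toggle p p∈I J x x∈F = swapAt p x , F-toggle p J x x∈F , related
    where
    related : θ I (swapAt p x) x
    related with reduce x ≟ p
    ... | yes x≡p = inj₂ (p∈I (Sum.swap x) (trans (reduce-swap x) x≡p) , p∈I x x≡p)
    ... | no  _   = inj₁ refl

  same-transfers : (p : Fin m) → (∀ x → reduce x ≡ p → x ∈ I) → ∀ π →
    Transfers identity (collapseSystem I (ℳ m π)) (collapseSystem I (ℳ m (π ⁻¹)))
  same-transfers p p∈I π = collapse-transfers I identity (ℳ m π) (ℳ m (π ⁻¹)) dom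
    where
    dom : ∀ S → Block (ℳ m π) S → Dominates I identity (ℳ m π) (ℳ m (π ⁻¹)) S
    dom S (inj₁ ((J , J≡π) , _ , J⊆S)) =
      F J , F (toggle p J) , F∈ℳ J J≡π , toggle∈ℳ p J J≡π
      , collapse-mono I (F J) S J⊆S
      , collapse-⊆ I (F J) (F (toggle p J)) (collapse-toggle p p∈I J)
      , collapse-⊆ I (F (toggle p J)) (F J) λ x x∈F →
          subst (λ K → x ∈ collapse I (F K)) (toggle-involutive p J)
            (collapse-toggle p p∈I (toggle p J) x x∈F)
    dom S (inj₂ (r , _ , r⊆S)) =
      G r , G r , G∈ℳ {π = π} r , G∈ℳ {π = π ⁻¹} r , collapse-mono I (G r) S r⊆S , id , id

  module _ (s : Fin m) (s∉I : ∀ x → x ∈ I → reduce x ≢ s) where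

    -- The exchange descends to the quotient because `I` avoids s and s′ and is thus fixed
    -- pointwise.
    swapping : Involution (E m / I)
    swapping = record
      { map        = swapAt s
      ; map-cong   = λ
        { (inj₁ refl)        → inj₁ refl
        ; (inj₂ (x∈I , y∈I)) → inj₂ (fixed x∈I , fixed y∈I) }
      ; involutive = λ x → inj₁ (swapAt-involutive s x)
      }
      where
      fixed : ∀ {x} → x ∈ I → swapAt s x ∈ I
      fixed {x} x∈I = subst (_∈ I) (sym (swapAt-≢ s x (s∉I x x∈I))) x∈I

    preimage-collapse : ∀ S T → (∀ x → x ∈ S → swapAt s x ∈ T) → (∀ x → x ∈ T → swapAt s x ∈ S) →
      preimage swapping (collapse I S) ≐ collapse I T
    preimage-collapse S T S→T T→S =
        (λ { {y} (x , x∈S , xθsy) →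
          respects (collapse I T) {swapAt s x} {y}
            (θ.trans (Involution.map-cong swapping xθsy) (Involution.involutive swapping y))
            (∈-collapse I T (S→T x x∈S)) })
      , λ { {y} (x , x∈T , xθy) →
          swapAt s x , T→S x x∈T , Involution.map-cong swapping xθy }
      where module θ = Setoid (E m / I)

    -- Inclusion is asked only after collapsing, so this also covers the case where `S` is `G t`.
    F-dominates : ∀ {π} J S → parity ∣ J ∣ ≡ π → collapse I (F J) ⊆ collapse I S →
      Dominates I swapping (ℳ m π) (ℳ m (π ⁻¹)) S
    F-dominates J S J≡π J⊆S =
      F J , F (toggle s J) , F∈ℳ J J≡π , toggle∈ℳ s J J≡π , J⊆S
      , preimage-collapse (F J) (F (toggle s J)) (F-toggle s J) (F-toggle⁻ s J)

  module _ (m≥3 : 3 ≤ m) (a b : Fin m ⊎ Fin m) (a∈I : a ∈ I) (b∈I : b ∈ I)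
           (a≢b : reduce a ≢ reduce b) (a+1≢b : next (reduce a) ≢ reduce b)
           (s∉I : ∀ x → x ∈ I → reduce x ≢ next (reduce a)) where

    private
      t = reduce a
      s = next t

    -- `G t` omits t, t′ and s′. As s is in `K`, `F K` avoids s′; of t and t′ it contains only `a`,
    -- whose class is also that of `b`, a member of `G t`.
    F⊆G : ∀ K → a ∈ F K → s ∈ᶠ K → collapse I (F K) ⊆ collapse I (G t)
    F⊆G K a∈F s∈K = collapse-⊆ I (F K) (G t) inG
      where
      b∈G : b ∈ G t
      b∈G = reduce≢⇒∈G t b (a≢b ∘ sym) λ { refl → a+1≢b refl }

      inG : ∀ x → x ∈ F K → x ∈ collapse I (G t)
      inG x x∈F with reduce x ≟ t
      ... | no  x≢t =
        ∈-collapse I (G t) (reduce≢⇒∈G t x x≢t λ { refl → x∈F s∈K })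
      ... | yes x≡t with ≡-or-swap x a x≡t
      ...   | inj₁ refl = b , b∈G , inj₂ (b∈I , a∈I)
      ...   | inj₂ refl = ⊥-elim (swap∉F K a a∈F x∈F)

    distinct-transfers : ∀ π → Transfers (swapping s s∉I)
      (collapseSystem I (ℳ m π)) (collapseSystem I (ℳ m (π ⁻¹)))
    distinct-transfers π =
      collapse-transfers I (swapping s s∉I) (ℳ m π) (ℳ m (π ⁻¹)) dom
      where
      dom : ∀ S → Block (ℳ m π) S → Dominates I (swapping s s∉I) (ℳ m π) (ℳ m (π ⁻¹)) S
      dom S (inj₁ ((J , J≡π) , _ , J⊆S)) =
        F-dominates s s∉I J S J≡π (collapse-mono I (F J) S J⊆S)
      dom S (inj₂ (r , _ , r⊆S)) with r ≟ t
      ... | no r≢t =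
        G r , G r , G∈ℳ {π = π} r , G∈ℳ {π = π ⁻¹} r , collapse-mono I (G r) S r⊆S
        , preimage-collapse s s∉I (G r) (G r) swapG swapG
        where
        swapG : ∀ x → x ∈ G r → swapAt s x ∈ G r
        swapG x = G-swapAt s r x (r≢t ∘ next-injective r t)
      -- `G t` is replaced by some `F K` below it. The spare index for the parity of `K` is that of
      -- `b`, distinct from t and from s.
      ... | yes refl
        with K , K≡π , a∈F , s∈K ← ∃F-through-parity π (reduce b) a s a≢b a+1≢b (next≢ m≥3 t ∘ sym)
        = F-dominates s s∉I K S K≡π (collapse-mono I (G t) S r⊆S ∘ F⊆G K a∈F s∈K)

    distinct-≅ : system (ℳ₁ m m≥3 *[ I ]) ≅ system (ℳ₂ m m≥3 *[ I ])
    distinct-≅ = minimal-≅ (swapping s s∉I)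
      (collapseSystem I (ℳ m 1ℙ)) (collapseSystem I (ℳ m 0ℙ))
      -- The two directions are instances of one lemma, since `_⁻¹` computes on each parity.
      (distinct-transfers 1ℙ) (distinct-transfers 0ℙ)

proposition3p14 : (m : ℕ) (m≥3 : 3 ≤ m) → StronglyHypomorphic (ℳ₁ m m≥3) (ℳ₂ m m≥3)
proposition3p14 m m≥3 I (a , b , a≢b , I⇔) with reduce a ≟ reduce b
... | yes p≡q = minimal-≅ (identity I)
    (collapseSystem I (ℳ m 1ℙ)) (collapseSystem I (ℳ m 0ℙ))
    (same-transfers I p p∈I 1ℙ) (same-transfers I p p∈I 0ℙ)
  where
  p = reduce a

  -- Distinct elements with the same index p, so `I` is {p, p′}.
  b≡swap-a : b ≡ Sum.swap a
  b≡swap-a with ≡-or-swap b a (sym p≡q)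
  ... | inj₁ b≡a = ⊥-elim (a≢b (sym b≡a))
  ... | inj₂ eq  = eq

  p∈I : ∀ x → reduce x ≡ p → x ∈ I
  p∈I x x≡p with ≡-or-swap x a x≡p
  ... | inj₁ x≡a  = Equivalence.from (I⇔ x) (inj₁ x≡a)
  ... | inj₂ x≡a′ = Equivalence.from (I⇔ x) (inj₂ (trans x≡a′ (sym b≡swap-a)))
... | no p≢q with next (reduce a) ≟ reduce b
...   | no p+1≢q = distinct-≅ I m≥3 a b
  (Equivalence.from (I⇔ a) (inj₁ refl)) (Equivalence.from (I⇔ b) (inj₂ refl)) p≢q p+1≢q avoids
  where
  avoids : ∀ x → x ∈ I → reduce x ≢ next (reduce a)
  avoids x x∈I with Equivalence.to (I⇔ x) x∈I
  ... | inj₁ refl = next≢ m≥3 (reduce a) ∘ sym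
  ... | inj₂ refl = p+1≢q ∘ sym
-- Here p + 1 = q, so the roles of `a` and `b` are exchanged; q + 1 = p would give p + 2 = p.
...   | yes p+1≡q = distinct-≅ I m≥3 b a
  (Equivalence.from (I⇔ b) (inj₂ refl)) (Equivalence.from (I⇔ a) (inj₁ refl)) (p≢q ∘ sym) q+1≢p avoids
  where
  q+1≢p : next (reduce b) ≢ reduce a
  q+1≢p eq = next-next≢ m≥3 (reduce a) (trans (cong next p+1≡q) eq)

  avoids : ∀ x → x ∈ I → reduce x ≢ next (reduce b)
  avoids x x∈I with Equivalence.to (I⇔ x) x∈I
  ... | inj₁ refl = q+1≢p ∘ sym
  ... | inj₂ refl = next≢ m≥3 (reduce b) ∘ sym
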